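{- If $a\geq 2$ and $q>4a^2\log a$ are integers, then \[ \chi_{sc}(K_{a,q})\geq 2q+0.06\,a\sqrt{q\log a}. \]
   Context: $K_{a,q}$ is the complete bipartite graph with parts of sizes $a$ and $q$. For a graph $G=(V,E)$ and $f:V\to\mathbb{N}$, an $f$-assignment is an assignment of color lists $L(v)$ with $|L(v)|=f(v)$; $G$ is $f$-choosable if for every $f$-assignment $L$ there is a proper coloring $c$ with $c(v)\in L(v)$ for all $v$. The sum choice number $\chi_{sc}(G)$ is the minimum of $\sum_{v\in V}f(v)$ over all $f$ such that $G$ is $f$-choosable. $\log$ denotes the natural logarithm. -}

module Defs where

open import Data.Nat as ℕ using (ℕ; zero; suc)
open import Data.Fin using (Fin; toℕ)
open import Data.List using (List; length)
open import Data.List.Membership.Propositional using (_∈_)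
open import Data.List.Relation.Unary.Unique.Propositional using (Unique)
open import Data.Vec using (sum; tabulate)
open import Data.Product using (_×_; ∃-syntax; Σ)
open import Data.Sum using (_⊎_)
open import Data.Integer using (+_)
open import Data.Rational using (ℚ; _/_; 0ℚ; 1ℚ; _+_; _*_; _<_; _≤_)
open import Relation.Binary.PropositionalEquality using (_≡_; _≢_)

record Assignment (n : ℕ) (f : Fin n → ℕ) : Set where
  field
    L        : Fin n → List ℕ
    distinct : ∀ v → Unique (L v)
    size     : ∀ v → length (L v) ≡ f v

ProperListColouring : {n : ℕ} (Adj : Fin n → Fin n → Set) (L : Fin n → List ℕ) → Set
ProperListColouring {n} Adj L =
  Σ (Fin n → ℕ) λ c → ((∀ (v : Fin n) → c v ∈ L v) × (∀ (u v : Fin n) → Adj u v → c u ≢ c v))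

Choosable : {n : ℕ} (Adj : Fin n → Fin n → Set) (f : Fin n → ℕ) → Set
Choosable {n} Adj f = (A : Assignment n f) → ProperListColouring Adj (Assignment.L A)

total : {n : ℕ} → (Fin n → ℕ) → ℕ
total f = sum (tabulate f)

K : (a q : ℕ) → Fin (a ℕ.+ q) → Fin (a ℕ.+ q) → Set
K a q i j = (toℕ i ℕ.< a × a ℕ.≤ toℕ j) ⊎ (a ℕ.≤ toℕ i × toℕ j ℕ.< a)

ℕtoℚ : ℕ → ℚ
ℕtoℚ n = (+ n) / 1

expTerm : ℚ → ℕ → ℚ
expTerm y zero    = 1ℚ
expTerm y (suc k) = expTerm y k * y * ((+ 1) / suc k)

expPartial : ℚ → ℕ → ℚ
expPartial y zero    = 0ℚ
expPartial y (suc N) = expPartial y N + expTerm y N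

-- LogLt a y  means  log a < y  (for natural a ≥ 1), i.e. a < e^y.
-- For y ≥ 0 the partial sums increase to e^y, so a < e^y iff some
-- partial sum exceeds a.
LogLt : ℕ → ℚ → Set
LogLt a y = (0ℚ ≤ y) × ∃[ N ] (ℕtoℚ a < expPartial y N)

{-# OPTIONS --safe #-}
module Submission where

-- Let t ≈ log₂ a, let A and B be the parts of sizes a and q, and write Σ f = 2q + d.
-- Distinct singleton lists on B show that B has fewer lists of size 1 than the shortest list
-- on A; so Σ_A f ≤ 2d and B has at least q - d lists of size 2. By Markov's inequality at least
-- 2 ^ t vertices of A have lists of size at most M = 2 (Σ_A f) / a. Split the colours into t classes,
-- each consisting of an even and an odd half of size m ≈ M / t, and give these vertices, indexed
-- by words β in {0,1}^t, lists inside the halves chosen by β. If the lists of size 2 on B contain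
-- all pairs {odd, even} within a class, then a proper colouring uses on A only one half of each
-- class, and the vertex with the complementary word cannot be coloured. Hence q - d < t m², which
-- bounds M, and thus d, from below.
-- Only log a < 3t and t < 4 log a are needed to replace t by the logarithm. The first
-- comes from three terms of the exponential series, the second from t^k / k! ≤ 2^(t+k-1).

open import Defs
open import Data.Nat as ℕ using (ℕ; zero; suc; z≤n; s≤s; NonZero)
import Data.Nat.Properties as ℕP
open import Data.Nat.Tactic.RingSolver using (solve-∀)
open import Data.Bool using (Bool; true; false; if_then_else_; not)
open import Data.Empty using (⊥)
open import Data.Fin as Fin using (Fin; zero; suc; toℕ; fromℕ<; _↑ˡ_; _↑ʳ_; splitAt)
open import Data.Fin.Properties using (any?; toℕ-fromℕ<; toℕ<n; toℕ-↑ˡ; toℕ-↑ʳ; splitAt-↑ˡ; splitAt-↑ʳ; splitAt⁻¹-↑ˡ; splitAt⁻¹-↑ʳ)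
open import Data.List using (List; []; _∷_; length; map; upTo; cartesianProductWith; cartesianProduct)
open import Data.List.Properties using (length-upTo; length-map; length-++)
open import Data.List.Membership.Propositional using (_∈_)
open import Data.List.Membership.Propositional.Properties using (∈-upTo⁺; ∈-upTo⁻; ∈-map⁻; ∈-cartesianProduct⁺; ∈-cartesianProductWith⁺)
open import Data.List.Relation.Unary.All using ([]; _∷_)
open import Data.List.Relation.Unary.AllPairs using ([]; _∷_)
open import Data.List.Relation.Unary.Any using (here; there)
open import Data.List.Relation.Unary.Unique.Propositional using (Unique)
open import Data.List.Relation.Unary.Unique.Propositional.Properties using (upTo⁺; map⁺)
open import Data.Product using (_×_; _,_; ∃-syntax; Σ; proj₁; proj₂)
open import Data.Rational as Q using (ℚ)
import Data.Rational.Properties as QP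
open import Data.Sum using (inj₁; inj₂; [_,_]′)
open import Data.Vec as Vec using (Vec; []; _∷_; lookup; tabulate)
open import Data.Vec.Properties using (lookup∘tabulate)
open import Function using (_∘_)
open import Level using (0ℓ)
open import Relation.Binary.PropositionalEquality
open import Relation.Nullary
open import Relation.Unary using (Pred; Decidable)

-- Estimates for the exponential series

module Exponential where

  open import Data.Integer as ℤ using (+_)
  import Data.Integer.Properties as ℤP
  open import Data.Nat using (_^_)
  open import Data.Rational using (_/_; 0ℚ; 1ℚ; _+_; _*_; _≤_; _<_; toℚᵘ; NonNegative; nonNegative; Positive; positive)
  open import Data.Rational.Properties
  open import Data.Rational.Solver using (module +-*-Solver)
  open +-*-Solver using (_:*_; _:+_; _:=_; con) renaming (solve to solveℚ)
  import Data.Rational.Unnormalised as ℚᵘ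
  open import Data.Rational.Unnormalised using (mkℚᵘ)
  import Data.Rational.Unnormalised.Properties as ℚᵘP

  -- Arithmetic and order of the naturals inside the rationals

  toℚᵘ-ℕtoℚ : ∀ n → toℚᵘ (ℕtoℚ n) ℚᵘ.≃ mkℚᵘ (+ n) 0
  toℚᵘ-ℕtoℚ n = toℚᵘ-fromℚᵘ (mkℚᵘ (+ n) 0)

  ℕtoℚ-+ : ∀ m n → ℕtoℚ (m ℕ.+ n) ≡ ℕtoℚ m + ℕtoℚ n
  ℕtoℚ-+ m n = toℚᵘ-injective (begin
    toℚᵘ (ℕtoℚ (m ℕ.+ n))                ≈⟨ toℚᵘ-ℕtoℚ (m ℕ.+ n) ⟩
    mkℚᵘ (+ (m ℕ.+ n)) 0                 ≈⟨ ℚᵘ.*≡* (cong (ℤ._* + 1) (sym (cong₂ ℤ._+_ (ℤP.*-identityʳ (+ m)) (ℤP.*-identityʳ (+ n))))) ⟩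
    mkℚᵘ (+ m) 0 ℚᵘ.+ mkℚᵘ (+ n) 0       ≈⟨ ℚᵘP.+-cong (toℚᵘ-ℕtoℚ m) (toℚᵘ-ℕtoℚ n) ⟨
    toℚᵘ (ℕtoℚ m) ℚᵘ.+ toℚᵘ (ℕtoℚ n)     ≈⟨ toℚᵘ-homo-+ (ℕtoℚ m) (ℕtoℚ n) ⟨
    toℚᵘ (ℕtoℚ m + ℕtoℚ n)               ∎)
    where open ℚᵘP.≃-Reasoning

  ℕtoℚ-* : ∀ m n → ℕtoℚ (m ℕ.* n) ≡ ℕtoℚ m * ℕtoℚ n
  ℕtoℚ-* m n = toℚᵘ-injective (begin
    toℚᵘ (ℕtoℚ (m ℕ.* n))                ≈⟨ toℚᵘ-ℕtoℚ (m ℕ.* n) ⟩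
    mkℚᵘ (+ (m ℕ.* n)) 0                 ≈⟨ ℚᵘ.*≡* (cong (ℤ._* + 1) (ℤP.pos-* m n)) ⟩
    mkℚᵘ (+ m) 0 ℚᵘ.* mkℚᵘ (+ n) 0       ≈⟨ ℚᵘP.*-cong (toℚᵘ-ℕtoℚ m) (toℚᵘ-ℕtoℚ n) ⟨
    toℚᵘ (ℕtoℚ m) ℚᵘ.* toℚᵘ (ℕtoℚ n)     ≈⟨ toℚᵘ-homo-* (ℕtoℚ m) (ℕtoℚ n) ⟨
    toℚᵘ (ℕtoℚ m * ℕtoℚ n)               ∎)
    where open ℚᵘP.≃-Reasoning

  ℕtoℚ-mono-≤ : ∀ {m n} → m ℕ.≤ n → ℕtoℚ m ≤ ℕtoℚ n
  ℕtoℚ-mono-≤ {m} {n} m≤n = toℚᵘ-cancel-≤ (begin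
    toℚᵘ (ℕtoℚ m)  ≃⟨ toℚᵘ-ℕtoℚ m ⟩
    mkℚᵘ (+ m) 0   ≤⟨ ℚᵘ.*≤* (ℤP.*-monoʳ-≤-nonNeg (+ 1) (ℤ.+≤+ m≤n)) ⟩
    mkℚᵘ (+ n) 0   ≃⟨ toℚᵘ-ℕtoℚ n ⟨
    toℚᵘ (ℕtoℚ n)  ∎)
    where open ℚᵘP.≤-Reasoning

  ℕtoℚ-cancel-< : ∀ {m n} → ℕtoℚ m < ℕtoℚ n → m ℕ.< n
  ℕtoℚ-cancel-< m<n = ℕP.≰⇒> λ n≤m → <-irrefl refl (<-≤-trans m<n (ℕtoℚ-mono-≤ n≤m))

  ℕtoℚ-mono-< : ∀ {m n} → m ℕ.< n → ℕtoℚ m < ℕtoℚ n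
  ℕtoℚ-mono-< {m} {n} m<n = toℚᵘ-cancel-< (begin-strict
    toℚᵘ (ℕtoℚ m)  ≃⟨ toℚᵘ-ℕtoℚ m ⟩
    mkℚᵘ (+ m) 0   <⟨ ℚᵘ.*<* (ℤP.*-monoʳ-<-pos (+ 1) (ℤ.+<+ m<n)) ⟩
    mkℚᵘ (+ n) 0   ≃⟨ toℚᵘ-ℕtoℚ n ⟨
    toℚᵘ (ℕtoℚ n)  ∎)
    where open ℚᵘP.≤-Reasoning

  ℕtoℚ-cancel-≤ : ∀ {m n} → ℕtoℚ m ≤ ℕtoℚ n → m ℕ.≤ n
  ℕtoℚ-cancel-≤ m≤n = ℕP.≮⇒≥ λ n<m → <-irrefl refl (<-≤-trans (ℕtoℚ-mono-< n<m) m≤n)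

  1/suc : ℕ → ℚ
  1/suc k = (+ 1) / suc k

  1/suc-nonNeg : ∀ k → NonNegative (1/suc k)
  1/suc-nonNeg k = nonNegative (toℚᵘ-cancel-≤ (begin
    ℚᵘ.0ℚᵘ            ≤⟨ ℚᵘP.nonNegative⁻¹ (mkℚᵘ (+ 1) k) ⟩
    mkℚᵘ (+ 1) k      ≃⟨ toℚᵘ-fromℚᵘ (mkℚᵘ (+ 1) k) ⟨
    toℚᵘ (1/suc k)    ∎))
    where open ℚᵘP.≤-Reasoning

  ℕtoℚ-suc*1/suc : ∀ k → ℕtoℚ (suc k) * 1/suc k ≡ 1ℚ
  ℕtoℚ-suc*1/suc k = toℚᵘ-injective (begin
    toℚᵘ (ℕtoℚ (suc k) * 1/suc k)            ≈⟨ toℚᵘ-homo-* (ℕtoℚ (suc k)) (1/suc k) ⟩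
    toℚᵘ (ℕtoℚ (suc k)) ℚᵘ.* toℚᵘ (1/suc k)  ≈⟨ ℚᵘP.*-cong (toℚᵘ-ℕtoℚ (suc k)) (toℚᵘ-fromℚᵘ (mkℚᵘ (+ 1) k)) ⟩
    mkℚᵘ (+ suc k) 0 ℚᵘ.* mkℚᵘ (+ 1) k       ≈⟨ ℚᵘ.*≡* (cong +_ (lemma k)) ⟩
    ℚᵘ.1ℚᵘ                                   ∎)
    where
    open ℚᵘP.≃-Reasoning
    lemma : ∀ k → suc k ℕ.* 1 ℕ.* 1 ≡ 1 ℕ.* (1 ℕ.* suc k)
    lemma = solve-∀

  r*k≤p⇒r≤p/k : ∀ {k p r} → r * ℕtoℚ (suc k) ≤ p → r ≤ p * 1/suc k
  r*k≤p⇒r≤p/k {k} {p} {r} rk≤p = begin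
    r                               ≡⟨ *-identityʳ r ⟨
    r * 1ℚ                          ≡⟨ cong (r *_) (ℕtoℚ-suc*1/suc k) ⟨
    r * (ℕtoℚ (suc k) * 1/suc k)    ≡⟨ *-assoc r _ _ ⟨
    r * ℕtoℚ (suc k) * 1/suc k      ≤⟨ *-monoʳ-≤-nonNeg (1/suc k) {{1/suc-nonNeg k}} rk≤p ⟩
    p * 1/suc k                     ∎
    where open ≤-Reasoning

  p≤r*k⇒p/k≤r : ∀ {k p r} → p ≤ r * ℕtoℚ (suc k) → p * 1/suc k ≤ r
  p≤r*k⇒p/k≤r {k} {p} {r} p≤rk = begin
    p * 1/suc k                     ≤⟨ *-monoʳ-≤-nonNeg (1/suc k) {{1/suc-nonNeg k}} p≤rk ⟩
    r * ℕtoℚ (suc k) * 1/suc k      ≡⟨ *-assoc r _ _ ⟩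
    r * (ℕtoℚ (suc k) * 1/suc k)    ≡⟨ cong (r *_) (ℕtoℚ-suc*1/suc k) ⟩
    r * 1ℚ                          ≡⟨ *-identityʳ r ⟩
    r                               ∎
    where open ≤-Reasoning

  *-mono-≤-nonNeg : ∀ {p q r s} → 0ℚ ≤ p → 0ℚ ≤ s → p ≤ q → r ≤ s → p * r ≤ q * s
  *-mono-≤-nonNeg {p} {q} {r} {s} 0≤p 0≤s p≤q r≤s = ≤-trans
    (*-monoˡ-≤-nonNeg p {{nonNegative 0≤p}} r≤s)
    (*-monoʳ-≤-nonNeg s {{nonNegative 0≤s}} p≤q)

  0≤ℕtoℚ : ∀ n → 0ℚ ≤ ℕtoℚ n
  0≤ℕtoℚ n = ℕtoℚ-mono-≤ {0} {n} z≤n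

  -- Lower bounds on terms and partial sums

  expTerm-nonNeg : ∀ {y} → 0ℚ ≤ y → ∀ k → 0ℚ ≤ expTerm y k
  expTerm-nonNeg 0≤y zero    = 0≤ℕtoℚ 1
  expTerm-nonNeg {y} 0≤y (suc k) = r*k≤p⇒r≤p/k {k} {expTerm y k * y} {0ℚ} (begin
    0ℚ * ℕtoℚ (suc k)  ≡⟨ *-zeroˡ (ℕtoℚ (suc k)) ⟩
    0ℚ                 ≡⟨ *-zeroˡ 0ℚ ⟨
    0ℚ * 0ℚ            ≤⟨ *-mono-≤-nonNeg ≤-refl 0≤y (expTerm-nonNeg 0≤y k) 0≤y ⟩
    expTerm y k * y    ∎)
    where open ≤-Reasoning

  -- Consecutive terms have ratio y / (k + 1), which is at least `r` by the second hypothesis.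
  expTerm-step-≥ : ∀ {y} k (c r : ℕ) → ℕtoℚ c ≤ expTerm y k → ℕtoℚ (r ℕ.* suc k) ≤ y →
    ℕtoℚ (c ℕ.* r) ≤ expTerm y (suc k)
  expTerm-step-≥ {y} k c r c≤ rk≤y = r*k≤p⇒r≤p/k {k} {expTerm y k * y} (begin
    ℕtoℚ (c ℕ.* r) * ℕtoℚ (suc k)    ≡⟨ ℕtoℚ-* (c ℕ.* r) (suc k) ⟨
    ℕtoℚ (c ℕ.* r ℕ.* suc k)         ≡⟨ cong ℕtoℚ (ℕP.*-assoc c r (suc k)) ⟩
    ℕtoℚ (c ℕ.* (r ℕ.* suc k))       ≡⟨ ℕtoℚ-* c (r ℕ.* suc k) ⟩
    ℕtoℚ c * ℕtoℚ (r ℕ.* suc k)      ≤⟨ *-mono-≤-nonNeg (0≤ℕtoℚ c) (≤-trans (0≤ℕtoℚ (r ℕ.* suc k)) rk≤y) c≤ rk≤y ⟩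
    expTerm y k * y                  ∎)
    where open ≤-Reasoning

  expTerm≥3^k : ∀ {y t} → ℕtoℚ (3 ℕ.* t) ≤ y → ∀ k → k ℕ.≤ t → ℕtoℚ (3 ^ k) ≤ expTerm y k
  expTerm≥3^k 3t≤y zero    _   = ≤-refl
  expTerm≥3^k {y} 3t≤y (suc k) k<t = subst (λ n → ℕtoℚ n ≤ expTerm y (suc k)) (ℕP.*-comm (3 ^ k) 3)
    (expTerm-step-≥ k (3 ^ k) 3 (expTerm≥3^k 3t≤y k (ℕP.<⇒≤ k<t))
      (≤-trans (ℕtoℚ-mono-≤ (ℕP.*-monoʳ-≤ 3 k<t)) 3t≤y))

  expPartial≥1 : ∀ {y} → 0ℚ ≤ y → ∀ N .{{_ : NonZero N}} → 1ℚ ≤ expPartial y N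
  expPartial≥1 0≤y 1 = ≤-refl
  expPartial≥1 {y} 0≤y (suc N@(suc _)) = begin
    1ℚ                             ≡⟨ +-identityʳ 1ℚ ⟨
    1ℚ + 0ℚ                        ≤⟨ +-mono-≤ (expPartial≥1 0≤y N) (expTerm-nonNeg 0≤y N) ⟩
    expPartial y N + expTerm y N   ∎
    where open ≤-Reasoning

  -- Turns `a + 3 ≤ 4 * 2 ^ t` into a ≤ 2 * 3 ^ t. Tripling the right side makes the constant too
  -- large by 6, which the spare `4 * 2 ^ t` on the left pays for.
  4*2^t≤2*3^t+3 : ∀ t .{{_ : NonZero t}} → 4 ℕ.* 2 ^ t ℕ.≤ 2 ℕ.* 3 ^ t ℕ.+ 3
  4*2^t≤2*3^t+3 1 = ℕP.n≤1+n 8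
  4*2^t≤2*3^t+3 (suc t@(suc u)) = ℕP.+-cancelʳ-≤ 6 _ _ (begin
    4 ℕ.* (2 ℕ.* 2 ^ t) ℕ.+ 6           ≤⟨ ℕP.+-monoʳ-≤ (4 ℕ.* (2 ℕ.* 2 ^ t)) (begin
        6                                 ≤⟨ ℕP.m≤m+n 6 2 ⟩
        4 ℕ.* 2                           ≤⟨ ℕP.*-monoʳ-≤ 4 (ℕP.*-monoʳ-≤ 2 (ℕP.m^n>0 2 u)) ⟩
        4 ℕ.* 2 ^ t                       ∎) ⟩
    4 ℕ.* (2 ℕ.* 2 ^ t) ℕ.+ 4 ℕ.* 2 ^ t   ≡⟨ left (2 ^ t) ⟩
    3 ℕ.* (4 ℕ.* 2 ^ t)                 ≤⟨ ℕP.*-monoʳ-≤ 3 (4*2^t≤2*3^t+3 t) ⟩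
    3 ℕ.* (2 ℕ.* 3 ^ t ℕ.+ 3)           ≡⟨ right (3 ^ t) ⟩
    2 ℕ.* (3 ℕ.* 3 ^ t) ℕ.+ 3 ℕ.+ 6     ∎)
    where
    open ℕP.≤-Reasoning
    left : ∀ x → 4 ℕ.* (2 ℕ.* x) ℕ.+ 4 ℕ.* x ≡ 3 ℕ.* (4 ℕ.* x)
    left = solve-∀
    right : ∀ x → 3 ℕ.* (2 ℕ.* x ℕ.+ 3) ≡ 2 ℕ.* (3 ℕ.* x) ℕ.+ 3 ℕ.+ 6
    right = solve-∀

  -- The summands of index 0, t and t + 1 of the exponential series already suffice.
  3t≤y⇒LogLt : ∀ {a t y} .{{_ : NonZero t}} → a ℕ.+ 3 ℕ.≤ 4 ℕ.* 2 ^ t → ℕtoℚ (3 ℕ.* t) ≤ y → LogLt a y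
  3t≤y⇒LogLt {a} {t@(suc u)} {y} a≤ 3t≤y = 0≤y , suc (suc t) , (begin-strict
    ℕtoℚ a                                        <⟨ ℕtoℚ-mono-< a< ⟩
    ℕtoℚ (1 ℕ.+ 3 ^ t ℕ.+ 3 ^ t)                  ≡⟨ ℕtoℚ-+ (1 ℕ.+ 3 ^ t) (3 ^ t) ⟩
    ℕtoℚ (1 ℕ.+ 3 ^ t) + ℕtoℚ (3 ^ t)             ≡⟨ cong (_+ ℕtoℚ (3 ^ t)) (ℕtoℚ-+ 1 (3 ^ t)) ⟩
    1ℚ + ℕtoℚ (3 ^ t) + ℕtoℚ (3 ^ t)              ≤⟨ +-mono-≤ (+-mono-≤ (expPartial≥1 0≤y t) (expTerm≥3^k 3t≤y t ℕP.≤-refl)) last ⟩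
    expPartial y t + expTerm y t + expTerm y (suc t) ∎)
    where
    open ≤-Reasoning
    0≤y : 0ℚ ≤ y
    0≤y = ≤-trans (0≤ℕtoℚ (3 ℕ.* t)) 3t≤y

    a< : a ℕ.< 1 ℕ.+ 3 ^ t ℕ.+ 3 ^ t
    a< = s≤s (ℕP.+-cancelʳ-≤ 3 _ _ (subst (λ z → a ℕ.+ 3 ℕ.≤ 3 ^ t ℕ.+ z ℕ.+ 3) (ℕP.+-identityʳ (3 ^ t))
           (ℕP.≤-trans a≤ (4*2^t≤2*3^t+3 t))))

    -- The ratio of this last term to its predecessor is at least 1, since t + 1 ≤ 3 t for positive
    -- t.
    last : ℕtoℚ (3 ^ t) ≤ expTerm y (suc t)
    last = subst (λ n → ℕtoℚ n ≤ expTerm y (suc t)) (ℕP.*-identityʳ (3 ^ t))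
      (expTerm-step-≥ t (3 ^ t) 1 (expTerm≥3^k 3t≤y t ℕP.≤-refl)
        (≤-trans (ℕtoℚ-mono-≤ (ℕP.≤-trans (ℕP.≤-reflexive (ℕP.*-identityˡ (suc t)))
          (ℕP.≤-trans (s≤s (ℕP.m≤m+n t _)) (ℕP.≤-reflexive (split u))))) 3t≤y))
      where
      split : ∀ u → suc (suc u ℕ.+ (u ℕ.+ suc u)) ≡ 3 ℕ.* suc u
      split = solve-∀

  -- Upper bounds on terms and partial sums

  -- Counts the multisets of size k from t elements; the recursion asks whether a fixed element is
  -- absent or occurs.
  multichoose : ℕ → ℕ → ℕ
  multichoose t       zero    = 1
  multichoose zero    (suc k) = 0
  multichoose (suc t) (suc k) = multichoose t (suc k) ℕ.+ multichoose (suc t) k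

  -- Consecutive values have ratio (t + k) / (k + 1), to be compared with the ratio t / (k + 1) of
  -- the numbers t^k / k!.
  multichoose-absorb : ∀ t k → suc k ℕ.* multichoose t (suc k) ≡ (t ℕ.+ k) ℕ.* multichoose t k
  multichoose-absorb zero    zero    = refl
  multichoose-absorb zero    (suc k) = trans (ℕP.*-zeroʳ k) (sym (ℕP.*-zeroʳ k))
  multichoose-absorb (suc t) zero    = begin
    1 ℕ.* (multichoose t 1 ℕ.+ 1)        ≡⟨ ℕP.*-distribˡ-+ 1 (multichoose t 1) 1 ⟩
    1 ℕ.* multichoose t 1 ℕ.+ 1          ≡⟨ cong (ℕ._+ 1) (multichoose-absorb t zero) ⟩
    (t ℕ.+ 0) ℕ.* 1 ℕ.+ 1                ≡⟨ ring t ⟩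
    (suc t ℕ.+ 0) ℕ.* 1                  ∎
    where
    open ≡-Reasoning
    ring : ∀ t → (t ℕ.+ 0) ℕ.* 1 ℕ.+ 1 ≡ (suc t ℕ.+ 0) ℕ.* 1
    ring = solve-∀
  multichoose-absorb (suc t) (suc k) = begin
    (2 ℕ.+ k) ℕ.* (multichoose t (2 ℕ.+ k) ℕ.+ (A ℕ.+ B))
      ≡⟨ ℕP.*-distribˡ-+ (2 ℕ.+ k) (multichoose t (2 ℕ.+ k)) (A ℕ.+ B) ⟩
    (2 ℕ.+ k) ℕ.* multichoose t (2 ℕ.+ k) ℕ.+ (2 ℕ.+ k) ℕ.* (A ℕ.+ B)
      ≡⟨ cong (ℕ._+ (2 ℕ.+ k) ℕ.* (A ℕ.+ B)) (multichoose-absorb t (suc k)) ⟩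
    (t ℕ.+ suc k) ℕ.* A ℕ.+ (2 ℕ.+ k) ℕ.* (A ℕ.+ B)
      ≡⟨ expand t k A B ⟩
    (t ℕ.+ suc k) ℕ.* A ℕ.+ (A ℕ.+ B) ℕ.+ suc k ℕ.* (A ℕ.+ B)
      ≡⟨ cong ((t ℕ.+ suc k) ℕ.* A ℕ.+ (A ℕ.+ B) ℕ.+_) (multichoose-absorb (suc t) k) ⟩
    (t ℕ.+ suc k) ℕ.* A ℕ.+ (A ℕ.+ B) ℕ.+ (suc t ℕ.+ k) ℕ.* B
      ≡⟨ collect t k A B ⟩
    (suc t ℕ.+ suc k) ℕ.* (A ℕ.+ B) ∎
    where
    open ≡-Reasoning
    A = multichoose t (suc k)
    B = multichoose (suc t) k
    expand : ∀ t k A B → (t ℕ.+ suc k) ℕ.* A ℕ.+ (2 ℕ.+ k) ℕ.* (A ℕ.+ B)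
      ≡ (t ℕ.+ suc k) ℕ.* A ℕ.+ (A ℕ.+ B) ℕ.+ suc k ℕ.* (A ℕ.+ B)
    expand = solve-∀
    collect : ∀ t k A B → (t ℕ.+ suc k) ℕ.* A ℕ.+ (A ℕ.+ B) ℕ.+ (suc t ℕ.+ k) ℕ.* B
      ≡ (suc t ℕ.+ suc k) ℕ.* (A ℕ.+ B)
    collect = solve-∀

  -- Both summands of the recursion get the same bound, since t + (k + 1) = (t + 1) + k.
  multichoose≤2^ : ∀ t k → multichoose (suc t) k ℕ.≤ 2 ^ (t ℕ.+ k)
  multichoose≤2^ t       zero    = ℕP.m^n>0 2 (t ℕ.+ 0)
  multichoose≤2^ zero    (suc k) = ℕP.≤-trans (multichoose≤2^ zero k) (ℕP.^-monoʳ-≤ 2 (ℕP.n≤1+n k))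
  multichoose≤2^ (suc t) (suc k) = begin
    multichoose (suc t) (suc k) ℕ.+ multichoose (2 ℕ.+ t) k  ≤⟨ ℕP.+-mono-≤ (multichoose≤2^ t (suc k)) (multichoose≤2^ (suc t) k) ⟩
    2 ^ (t ℕ.+ suc k) ℕ.+ 2 ^ (suc t ℕ.+ k)                  ≡⟨ cong (λ n → 2 ^ (t ℕ.+ suc k) ℕ.+ 2 ^ n) (ℕP.+-suc t k) ⟨
    2 ^ (t ℕ.+ suc k) ℕ.+ 2 ^ (t ℕ.+ suc k)                  ≡⟨ cong (2 ^ (t ℕ.+ suc k) ℕ.+_) (ℕP.+-identityʳ (2 ^ (t ℕ.+ suc k))) ⟨
    2 ^ (suc t ℕ.+ suc k)                                    ∎
    where open ℕP.≤-Reasoning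

  ℕtoℚ-pos : ∀ n .{{_ : NonZero n}} → Positive (ℕtoℚ n)
  ℕtoℚ-pos n = positive (ℕtoℚ-mono-< (ℕ.>-nonZero⁻¹ n))

  -- t ^ k / k ! is at most the number of multisets of size k from t elements.
  expTerm*4^k≤multichoose : ∀ {y t} → 0ℚ ≤ y → ℕtoℚ 4 * y ≤ ℕtoℚ t → ∀ k →
    expTerm y k * ℕtoℚ (4 ^ k) ≤ ℕtoℚ (multichoose t k)
  expTerm*4^k≤multichoose 0≤y 4y≤t zero = ≤-reflexive (*-identityʳ 1ℚ)
  expTerm*4^k≤multichoose {y} {t} 0≤y 4y≤t (suc k) = begin
    T * y * 1/suc k * ℕtoℚ (4 ℕ.* 4 ^ k)            ≡⟨ cong (T * y * 1/suc k *_) (ℕtoℚ-* 4 (4 ^ k)) ⟩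
    T * y * 1/suc k * (ℕtoℚ 4 * ℕtoℚ (4 ^ k))       ≡⟨ solveℚ 5 (λ T y d f p → T :* y :* d :* (f :* p) := T :* p :* (f :* y) :* d) refl T y (1/suc k) (ℕtoℚ 4) (ℕtoℚ (4 ^ k)) ⟩
    T * ℕtoℚ (4 ^ k) * (ℕtoℚ 4 * y) * 1/suc k       ≤⟨ p≤r*k⇒p/k≤r {k} (begin
        T * ℕtoℚ (4 ^ k) * (ℕtoℚ 4 * y)                 ≤⟨ *-mono-≤-nonNeg 0≤T4^k (0≤ℕtoℚ t) (expTerm*4^k≤multichoose 0≤y 4y≤t k) 4y≤t ⟩
        ℕtoℚ (multichoose t k) * ℕtoℚ t                 ≡⟨ ℕtoℚ-* (multichoose t k) t ⟨
        ℕtoℚ (multichoose t k ℕ.* t)                    ≤⟨ ℕtoℚ-mono-≤ absorb ⟩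
        ℕtoℚ (multichoose t (suc k) ℕ.* suc k)          ≡⟨ ℕtoℚ-* (multichoose t (suc k)) (suc k) ⟩
        ℕtoℚ (multichoose t (suc k)) * ℕtoℚ (suc k)     ∎) ⟩
    ℕtoℚ (multichoose t (suc k))                    ∎
    where
    open ≤-Reasoning
    T = expTerm y k

    0≤T4^k : 0ℚ ≤ T * ℕtoℚ (4 ^ k)
    0≤T4^k = subst (_≤ T * ℕtoℚ (4 ^ k)) (*-zeroˡ 0ℚ)
      (*-mono-≤-nonNeg ≤-refl (0≤ℕtoℚ (4 ^ k)) (expTerm-nonNeg 0≤y k) (0≤ℕtoℚ (4 ^ k)))

    absorb : multichoose t k ℕ.* t ℕ.≤ multichoose t (suc k) ℕ.* suc k
    absorb = ℕP.≤-trans (ℕP.*-monoʳ-≤ (multichoose t k) (ℕP.m≤m+n t k))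
      (ℕP.≤-reflexive (trans (ℕP.*-comm (multichoose t k) (t ℕ.+ k))
        (trans (sym (multichoose-absorb t k)) (ℕP.*-comm (suc k) (multichoose t (suc k))))))

  -- With t = `suc u`, the term times 4^k is at most 2^(u+k). One factor 2^k cancels this growth;
  -- the other leaves geometric decay.
  expTerm*2^k≤2^u : ∀ {y u} → 0ℚ ≤ y → ℕtoℚ 4 * y ≤ ℕtoℚ (suc u) → ∀ k → expTerm y k * ℕtoℚ (2 ^ k) ≤ ℕtoℚ (2 ^ u)
  expTerm*2^k≤2^u {y} {u} 0≤y 4y≤t k = *-cancelʳ-≤-pos (ℕtoℚ (2 ^ k)) {{ℕtoℚ-pos (2 ^ k) {{ℕP.m^n≢0 2 k}}}} (begin
    expTerm y k * ℕtoℚ (2 ^ k) * ℕtoℚ (2 ^ k)    ≡⟨ *-assoc (expTerm y k) _ _ ⟩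
    expTerm y k * (ℕtoℚ (2 ^ k) * ℕtoℚ (2 ^ k))  ≡⟨ cong (expTerm y k *_) (ℕtoℚ-* (2 ^ k) (2 ^ k)) ⟨
    expTerm y k * ℕtoℚ (2 ^ k ℕ.* 2 ^ k)         ≡⟨ cong (λ n → expTerm y k * ℕtoℚ n) 4^k≡ ⟨
    expTerm y k * ℕtoℚ (4 ^ k)                   ≤⟨ expTerm*4^k≤multichoose 0≤y 4y≤t k ⟩
    ℕtoℚ (multichoose (suc u) k)                 ≤⟨ ℕtoℚ-mono-≤ (multichoose≤2^ u k) ⟩
    ℕtoℚ (2 ^ (u ℕ.+ k))                         ≡⟨ cong ℕtoℚ (ℕP.^-distribˡ-+-* 2 u k) ⟩
    ℕtoℚ (2 ^ u ℕ.* 2 ^ k)                       ≡⟨ ℕtoℚ-* (2 ^ u) (2 ^ k) ⟩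
    ℕtoℚ (2 ^ u) * ℕtoℚ (2 ^ k)                  ∎)
    where
    open ≤-Reasoning
    4^k≡ : 4 ^ k ≡ 2 ^ k ℕ.* 2 ^ k
    4^k≡ = trans (ℕP.^-*-assoc 2 2 k)
      (trans (cong (λ n → 2 ^ (k ℕ.+ n)) (ℕP.+-identityʳ k)) (ℕP.^-distribˡ-+-* 2 k k))

  -- The geometric sum 2^(u+1) (1 - 2^(-N)) as an upper bound, multiplied by 2^N and written without
  -- subtraction.
  expPartial*2^N≤ : ∀ {y u} → 0ℚ ≤ y → ℕtoℚ 4 * y ≤ ℕtoℚ (suc u) → ∀ N →
    expPartial y N * ℕtoℚ (2 ^ N) + ℕtoℚ (2 ^ suc u) ≤ ℕtoℚ (2 ^ suc u) * ℕtoℚ (2 ^ N)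
  expPartial*2^N≤ {y} {u} 0≤y 4y≤t zero = ≤-reflexive (begin
    0ℚ * 1ℚ + ℕtoℚ (2 ^ suc u)    ≡⟨ cong (_+ ℕtoℚ (2 ^ suc u)) (*-zeroˡ 1ℚ) ⟩
    0ℚ + ℕtoℚ (2 ^ suc u)         ≡⟨ +-identityˡ _ ⟩
    ℕtoℚ (2 ^ suc u)              ≡⟨ *-identityʳ _ ⟨
    ℕtoℚ (2 ^ suc u) * 1ℚ         ∎)
    where open ≡-Reasoning
  expPartial*2^N≤ {y} {u} 0≤y 4y≤t (suc N) = begin
    (E + T) * ℕtoℚ (2 ℕ.* 2 ^ N) + P                 ≡⟨ cong (λ z → (E + T) * z + P) (ℕtoℚ-* 2 (2 ^ N)) ⟩
    (E + T) * (two * X) + P                          ≡⟨ solveℚ 5 (λ E T w X P → (E :+ T) :* (w :* X) :+ P := w :* (E :* X) :+ w :* (T :* X) :+ P) refl E T two X P ⟩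
    two * (E * X) + two * (T * X) + P                ≤⟨ +-monoˡ-≤ P (+-monoʳ-≤ (two * (E * X)) (*-monoˡ-≤-nonNeg two (expTerm*2^k≤2^u {u = u} 0≤y 4y≤t N))) ⟩
    two * (E * X) + two * ℕtoℚ (2 ^ u) + P           ≡⟨ cong (λ z → two * (E * X) + z + P) (ℕtoℚ-* 2 (2 ^ u)) ⟨
    two * (E * X) + P + P                            ≡⟨ solveℚ 3 (λ w Z P → w :* Z :+ P :+ P := w :* Z :+ (con 1ℚ :+ con 1ℚ) :* P) refl two (E * X) P ⟩
    two * (E * X) + two * P                          ≡⟨ *-distribˡ-+ two (E * X) P ⟨
    two * (E * X + P)                                ≤⟨ *-monoˡ-≤-nonNeg two (expPartial*2^N≤ {u = u} 0≤y 4y≤t N) ⟩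
    two * (P * X)                                    ≡⟨ solveℚ 3 (λ w P X → w :* (P :* X) := P :* (w :* X)) refl two P X ⟩
    P * (two * X)                                    ≡⟨ cong (P *_) (ℕtoℚ-* 2 (2 ^ N)) ⟨
    P * ℕtoℚ (2 ℕ.* 2 ^ N)                           ∎
    where
    open ≤-Reasoning
    two = ℕtoℚ 2
    E = expPartial y N
    T = expTerm y N
    X = ℕtoℚ (2 ^ N)
    P = ℕtoℚ (2 ^ suc u)

  -- If 4 y ≤ t, every partial sum stays at most 2^t ≤ a, so none can witness log a < y.
  LogLt⇒t<4y : ∀ {a t y} .{{_ : NonZero t}} → 2 ^ t ℕ.≤ a → LogLt a y → ℕtoℚ t < ℕtoℚ 4 * y
  LogLt⇒t<4y {a} {t@(suc u)} {y} 2^t≤a (0≤y , N , a<E) = ≰⇒> λ 4y≤t → <-irrefl refl (begin-strict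
    ℕtoℚ a           <⟨ a<E ⟩
    expPartial y N   ≤⟨ *-cancelʳ-≤-pos (ℕtoℚ (2 ^ N)) {{ℕtoℚ-pos (2 ^ N) {{ℕP.m^n≢0 2 N}}}}
                          (≤-trans p≤p+2^t (expPartial*2^N≤ {u = u} 0≤y 4y≤t N)) ⟩
    ℕtoℚ (2 ^ t)     ≤⟨ ℕtoℚ-mono-≤ 2^t≤a ⟩
    ℕtoℚ a           ∎)
    where
    open ≤-Reasoning
    p≤p+2^t : ∀ {p} → p ≤ p + ℕtoℚ (2 ^ t)
    p≤p+2^t {p} = subst (_≤ p + ℕtoℚ (2 ^ t)) (+-identityʳ p) (+-monoʳ-≤ p (0≤ℕtoℚ (2 ^ t)))

open Exponential
open import Data.Nat
open import Data.Nat.DivMod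
open import Data.Nat.Properties

-- Sums and counts over finite index types

total-mono : ∀ {n} {f g : Fin n → ℕ} → (∀ i → f i ≤ g i) → total f ≤ total g
total-mono {zero}  f≤g = z≤n
total-mono {suc n} f≤g = +-mono-≤ (f≤g zero) (total-mono (f≤g ∘ suc))

total-const : ∀ n c → total {n} (λ _ → c) ≡ n * c
total-const zero    c = refl
total-const (suc n) c = cong (c +_) (total-const n c)

total-+ : ∀ {n} (f g : Fin n → ℕ) → total (λ i → f i + g i) ≡ total f + total g
total-+ {zero}  f g = refl
total-+ {suc n} f g rewrite total-+ (f ∘ suc) (g ∘ suc) =
  interchange (f zero) (g zero) (total (f ∘ suc)) (total (g ∘ suc))
  where
  interchange : ∀ w x y z → (w + x) + (y + z) ≡ (w + y) + (x + z)
  interchange = solve-∀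

total-* : ∀ {n} c (f : Fin n → ℕ) → total (λ i → c * f i) ≡ c * total f
total-* {zero}  c f = sym (*-zeroʳ c)
total-* {suc n} c f rewrite total-* c (f ∘ suc) = sym (*-distribˡ-+ c (f zero) (total (f ∘ suc)))

total-↑ : ∀ a {q} (f : Fin (a + q) → ℕ) → total f ≡ total (f ∘ (_↑ˡ q)) + total (f ∘ (a ↑ʳ_))
total-↑ zero    f = refl
total-↑ (suc a) f rewrite total-↑ a (f ∘ suc) = sym (+-assoc (f zero) _ _)

indicator : ∀ {n} {P : Pred (Fin n) 0ℓ} → Decidable P → Fin n → ℕ
indicator P? i = if does (P? i) then 1 else 0

count : ∀ {n} {P : Pred (Fin n) 0ℓ} → Decidable P → ℕ
count P? = total (indicator P?)

-- Distributes prescribed data over the vertices of suitable size: the elements of `xs` go in order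
-- to indices satisfying `P`, and all other indices receive the default.
label-covering : ∀ {X : Set} (default : X) {n} {P : Pred (Fin n) 0ℓ} (P? : Decidable P) (xs : List X) →
  length xs ≤ count P? → Σ (Fin n → X) λ label → ∀ {x} → x ∈ xs → ∃[ i ] (P i × label i ≡ x)
label-covering default P? [] _ = (λ _ → default) , λ ()
label-covering default {zero} P? (x ∷ xs) ()
label-covering default {suc n} P? (x ∷ xs) len with P? zero
... | yes p with label , covers ← label-covering default (P? ∘ suc) xs (s≤s⁻¹ len)
    = (λ { zero → x ; (suc i) → label i })
    , λ { (here refl) → zero , p , refl
        ; (there x∈xs) → let i , pi , eq = covers x∈xs in suc i , pi , eq }
... | no ¬p with label , covers ← label-covering default (P? ∘ suc) (x ∷ xs) len
    = (λ { zero → default ; (suc i) → label i })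
    , λ x∈xs → let i , pi , eq = covers x∈xs in suc i , pi , eq

upTo-size : ∀ n → Unique (upTo n) × length (upTo n) ≡ n
upTo-size n = upTo⁺ n , length-upTo n

-- Colours, words and pairs

length-cartesianProductWith : ∀ {X Y Z : Set} (g : X → Y → Z) xs ys →
  length (cartesianProductWith g xs ys) ≡ length xs * length ys
length-cartesianProductWith g []       ys = refl
length-cartesianProductWith g (x ∷ xs) ys
  rewrite length-++ (map (g x) ys) {cartesianProductWith g xs ys}
        | length-map (g x) ys | length-cartesianProductWith g xs ys = refl

bitVectors : ∀ t → List (Vec Bool t)
bitVectors zero    = [] ∷ []
bitVectors (suc t) = cartesianProductWith _∷_ (true ∷ false ∷ []) (bitVectors t)

length-bitVectors : ∀ t → length (bitVectors t) ≡ 2 ^ t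
length-bitVectors zero    = refl
length-bitVectors (suc t) =
  trans (length-cartesianProductWith _∷_ (true ∷ false ∷ []) (bitVectors t)) (cong (2 *_) (length-bitVectors t))

∈-bitVectors : ∀ {t} (β : Vec Bool t) → β ∈ bitVectors t
∈-bitVectors []      = here refl
∈-bitVectors (b ∷ β) = ∈-cartesianProductWith⁺ _∷_ (∈-bits b) (∈-bitVectors β)
  where
  ∈-bits : ∀ b → b ∈ true ∷ false ∷ []
  ∈-bits true  = here refl
  ∈-bits false = there (here refl)

-- Quotient and remainder enumerate the pairs of positions below `m * t` congruent modulo `t`; they
-- index the lists {odd, even} within a class.
congruentPairs : ℕ → ℕ → List (ℕ × ℕ)
congruentPairs t m =
  cartesianProductWith (λ r (k , l) → r + k * t , r + l * t) (upTo t) (cartesianProduct (upTo m) (upTo m))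

length-congruentPairs : ∀ t m → length (congruentPairs t m) ≡ t * (m * m)
length-congruentPairs t m =
  trans (length-cartesianProductWith _ (upTo t) (cartesianProduct (upTo m) (upTo m)))
    (cong₂ _*_ (length-upTo t)
      (trans (length-cartesianProductWith _ (upTo m) (upTo m)) (cong₂ _*_ (length-upTo m) (length-upTo m))))

∈-congruentPairs : ∀ t .{{_ : NonZero t}} m {k l} → k < m * t → l < m * t → k % t ≡ l % t →
  (k , l) ∈ congruentPairs t m
∈-congruentPairs t m {k} {l} k< l< k≡l =
  subst (_∈ congruentPairs t m)
    (cong₂ _,_ (sym (m≡m%n+[m/n]*n k t)) (trans (cong (_+ l / t * t) k≡l) (sym (m≡m%n+[m/n]*n l t))))
    (∈-cartesianProductWith⁺ _ (∈-upTo⁺ (m%n<n k t))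
      (∈-cartesianProduct⁺ (∈-upTo⁺ (m<n*o⇒m/o<n {n = m} k<)) (∈-upTo⁺ (m<n*o⇒m/o<n {n = m} l<))))

bit : Bool → ℕ
bit true  = 1
bit false = 0

-- Position `n` belongs to the class `n % t`; the parity of the colour selects the half of that
-- class.
colour : ℕ → Bool → ℕ
colour n b = bit b + n * 2

colour-parity : ∀ k l → colour k true ≢ colour l false
colour-parity (suc k) (suc l) eq = colour-parity k l (suc-injective (suc-injective eq))

colour-injective : ∀ k l {b c} → colour k b ≡ colour l c → k ≡ l
colour-injective k l {true}  {true}  eq = *-cancelʳ-≡ k l 2 (suc-injective eq)
colour-injective k l {false} {false} eq = *-cancelʳ-≡ k l 2 eq
colour-injective k l {true}  {false} eq = contradiction eq (colour-parity k l)
colour-injective k l {false} {true}  eq = contradiction (sym eq) (colour-parity l k)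

-- Only the lists of size 2 set the trap; at other sizes any distinct colours serve.
pairList : ℕ × ℕ → ℕ → List ℕ
pairList (k , l) 2 = colour k true ∷ colour l false ∷ []
pairList _       n = upTo n

pairList-size : ∀ p n → Unique (pairList p n) × length (pairList p n) ≡ n
pairList-size p 0 = upTo-size 0
pairList-size p 1 = upTo-size 1
pairList-size (k , l) 2 = ((colour-parity k l ∷ []) ∷ [] ∷ []) , refl
pairList-size p (suc (suc (suc n))) = upTo-size (3 + n)

residue : ∀ t .{{_ : NonZero t}} → ℕ → Fin t
residue t n = fromℕ< (m%n<n n t)

residue-injective : ∀ t .{{_ : NonZero t}} {k l} → residue t k ≡ residue t l → k % t ≡ l % t
residue-injective t {k} {l} eq =
  trans (sym (toℕ-fromℕ< (m%n<n k t))) (trans (cong toℕ eq) (toℕ-fromℕ< (m%n<n l t)))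

-- The word β is chosen to avoid, in every residue class, the parity c already uses there:
-- its vertex then produces the second parity of some class.
both-parities : ∀ t .{{_ : NonZero t}} N {a} (c : Fin a → ℕ) →
  (∀ β → ∃[ i ] ∃[ n ] (n < N × c i ≡ colour n (lookup β (residue t n)))) →
  ∃[ i ] ∃[ i′ ] ∃[ k ] ∃[ l ]
    (k < N × l < N × k % t ≡ l % t × c i ≡ colour k true × c i′ ≡ colour l false)
both-parities t N c hits = find (hits (tabulate β))
  where
  odd? : ∀ r → Dec (∃[ i ] ∃[ k ] (k < N × (residue t k ≡ r × c i ≡ colour k true)))
  odd? r = any? λ i → anyUpTo? (λ k → (residue t k Fin.≟ r) ×-dec (c i ≟ colour k true)) N

  β : Fin t → Bool
  β r = not (does (odd? r))

  find : ∃[ i ] ∃[ n ] (n < N × c i ≡ colour n (lookup (tabulate β) (residue t n))) → _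
  find (i′ , l , l<N , eq) rewrite lookup∘tabulate β (residue t l) with odd? (residue t l)
  ... | yes (i , k , k<N , k≡l , eq′) = i , i′ , k , l , k<N , l<N , residue-injective t k≡l , eq′ , eq
  -- No vertex uses the odd half of this class, so the word asks for it, and the vertex found uses
  -- it after all.
  ... | no ¬odd = contradiction (i′ , l , l<N , refl , eq) ¬odd

-- Numerical estimates

dyadic-bounds : ∀ n .{{_ : NonZero n}} → ∃[ u ] (2 ^ u ≤ n × n < 2 ^ suc u)
dyadic-bounds 1 = 0 , ≤-refl , ≤-refl
dyadic-bounds (suc n@(suc _)) with u , lower , upper ← dyadic-bounds n with suc n <? 2 ^ suc u
... | yes below = u , ≤-trans lower (n≤1+n n) , below
... | no ¬below = suc u , ≮⇒≥ ¬below ,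
  ≤-<-trans upper (m<m+n (2 ^ suc u) (subst (0 <_) (sym (+-identityʳ (2 ^ suc u))) (m^n>0 2 (suc u))))

m<1+[m/n]*n : ∀ m n .{{_ : NonZero n}} → m < suc (m / n) * n
m<1+[m/n]*n m n = subst (_< suc (m / n) * n) (sym (m≡m%n+[m/n]*n m n)) (+-monoˡ-< (m / n * n) (m%n<n m n))

-- An entry above `M` is at least `suc M`, and any other is paid for by its indicator. This is
-- Markov's inequality for the complementary count.
markov : ∀ {n} (g : Fin n → ℕ) M → n * suc M ≤ total g + suc M * count (λ i → g i ≤? M)
markov {n} g M = begin
  n * suc M                                                 ≡⟨ total-const n (suc M) ⟨
  total {n} (λ _ → suc M)                                   ≤⟨ total-mono (λ i → pointwise (g i ≤? M)) ⟩
  total (λ i → g i + suc M * indicator (λ i → g i ≤? M) i)  ≡⟨ total-+ g _ ⟩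
  total g + total (λ i → suc M * indicator (λ i → g i ≤? M) i) ≡⟨ cong (total g +_) (total-* (suc M) (indicator (λ i → g i ≤? M))) ⟩
  total g + suc M * count (λ i → g i ≤? M)                  ∎
  where
  open ≤-Reasoning
  pointwise : ∀ {n} (n≤M? : Dec (n ≤ M)) → suc M ≤ n + suc M * (if does n≤M? then 1 else 0)
  pointwise {n} (yes _)   = ≤-trans (≤-reflexive (sym (*-identityʳ (suc M)))) (m≤n+m _ n)
  pointwise {n} (no n≰M)  = ≤-trans (≰⇒> n≰M) (m≤m+n n _)

-- The two sides differ by the square of the difference of `x` and `y`, here `k * k`.
[x+y]²≤2x²+2y² : ∀ x y → (x + y) * (x + y) ≤ 2 * (x * x) + 2 * (y * y)
[x+y]²≤2x²+2y² x y with ≤-total x y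
... | inj₁ x≤y with k , refl ← m≤n⇒∃[o]m+o≡n x≤y = ≤-trans (m≤m+n _ (k * k)) (≤-reflexive (expand x k))
  where
  expand : ∀ x k → (x + (x + k)) * (x + (x + k)) + k * k ≡ 2 * (x * x) + 2 * ((x + k) * (x + k))
  expand = solve-∀
... | inj₂ y≤x with k , refl ← m≤n⇒∃[o]m+o≡n y≤x = ≤-trans (m≤m+n _ (k * k)) (≤-reflexive (expand y k))
  where
  expand : ∀ y k → (y + k + y) * (y + k + y) + k * k ≡ 2 * ((y + k) * (y + k)) + 2 * (y * y)
  expand = solve-∀

square-cancel-< : ∀ x y → x * x < y * y → x < y
square-cancel-< x y x²<y² = ≰⇒> λ y≤x → <⇒≱ x²<y² (*-mono-≤ y≤x y≤x)

-- In units of t q, the summands 2 M², 2 t² and t d are at most 0.3456, 0.5 and 0.11.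
-- Numerals are kept as right factors because 10000 * n reduces by recursion on the numeral.
budget : ∀ a q t d M m → 2 ≤ a →
  d * d * 10000 < a * a * q * t * 108 → a * a * t ≤ q → a * M ≤ d * 4 →
  q ≤ t * (m * m) + d → m * t ≤ M + t → ⊥
budget a q t d M m 2≤a d²< a²t≤q aM≤4d q≤ mt≤ = <⇒≱ shortfall (*-monoʳ-≤ (t * q) (m≤m+n 9556 444))
  where
  open ≤-Reasoning

  -- 1728 is 16 * 108, the 16 coming from squaring a M ≤ 4 d.
  M²< : M * M * 10000 < q * t * 1728
  M²< = *-cancelˡ-< (a * a) _ _ (begin-strict
    a * a * (M * M * 10000)          ≡⟨ e₁ a M 10000 ⟩
    (a * M) * (a * M) * 10000        ≤⟨ *-monoˡ-≤ 10000 (*-mono-≤ aM≤4d aM≤4d) ⟩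
    (d * 4) * (d * 4) * 10000        ≡⟨ e₂ d 10000 ⟩
    d * d * 10000 * 16               <⟨ *-monoˡ-< 16 d²< ⟩
    a * a * q * t * 108 * 16         ≡⟨ e₃ a q t 108 16 ⟩
    a * a * (q * t * 1728)           ∎)
    where
    e₁ : ∀ a M c → a * a * (M * M * c) ≡ (a * M) * (a * M) * c
    e₁ = solve-∀
    e₂ : ∀ d c → (d * 4) * (d * 4) * c ≡ d * d * c * 16
    e₂ = solve-∀
    e₃ : ∀ a q t c e → a * a * q * t * c * e ≡ a * a * (q * t * (c * e))
    e₃ = solve-∀

  -- Weakening 108 to 121 makes the right side a square.
  d< : d * 100 < q * 11
  d< = square-cancel-< (d * 100) (q * 11) (begin-strict
    d * 100 * (d * 100)          ≡⟨ e₁ d 100 ⟩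
    d * d * 10000                <⟨ d²< ⟩
    a * a * q * t * 108          ≡⟨ cong (_* 108) (e₂ a q t) ⟩
    q * (a * a * t) * 108        ≤⟨ *-mono-≤ (*-monoʳ-≤ q a²t≤q) (m≤m+n 108 13) ⟩
    q * q * 121                  ≡⟨ e₁ q 11 ⟨
    q * 11 * (q * 11)            ∎)
    where
    e₁ : ∀ x c → x * c * (x * c) ≡ x * x * (c * c)
    e₁ = solve-∀
    e₂ : ∀ a q t → a * a * q * t ≡ q * (a * a * t)
    e₂ = solve-∀

  t*4≤q : t * 4 ≤ q
  t*4≤q = ≤-trans (≤-reflexive (*-comm t 4)) (≤-trans (*-monoˡ-≤ t (*-mono-≤ 2≤a 2≤a)) a²t≤q)

  shortfall : t * q * 10000 < t * q * 9556
  shortfall = begin-strict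
    t * q * 10000
      ≤⟨ *-monoˡ-≤ 10000 (*-monoʳ-≤ t q≤) ⟩
    t * (t * (m * m) + d) * 10000
      ≡⟨ cong (_* 10000) (e₁ t m d) ⟩
    (m * t * (m * t) + t * d) * 10000
      ≤⟨ *-monoˡ-≤ 10000 (+-monoˡ-≤ (t * d) (≤-trans (*-mono-≤ mt≤ mt≤) ([x+y]²≤2x²+2y² M t))) ⟩
    (2 * (M * M) + 2 * (t * t) + t * d) * 10000
      ≡⟨ *-distribʳ-+ 10000 (2 * (M * M) + 2 * (t * t)) (t * d) ⟩
    (2 * (M * M) + 2 * (t * t)) * 10000 + t * d * 10000
      ≡⟨ e₂ M t d 5000 100 ⟩
    M * M * 10000 * 2 + t * (t * 4) * 5000 + t * (d * 100) * 100
      <⟨ +-mono-<-≤ (+-mono-<-≤ (*-monoˡ-< 2 M²<) (*-monoˡ-≤ 5000 (*-monoʳ-≤ t t*4≤q)))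
           (*-monoˡ-≤ 100 (*-monoʳ-≤ t (<⇒≤ d<))) ⟩
    q * t * 1728 * 2 + t * q * 5000 + t * (q * 11) * 100
      ≡⟨ e₃ t q 1728 5000 11 100 ⟩
    t * q * 9556 ∎
    where
    e₁ : ∀ t m d → t * (t * (m * m) + d) ≡ m * t * (m * t) + t * d
    e₁ = solve-∀
    e₂ : ∀ M t d c e → (2 * (M * M) + 2 * (t * t)) * (c * 2) + t * d * (e * e)
      ≡ M * M * (c * 2) * 2 + t * (t * 4) * c + t * (d * e) * e
    e₂ = solve-∀
    e₃ : ∀ t q x y z w → q * t * x * 2 + t * q * y + t * (q * z) * w ≡ t * q * (x * 2 + y + z * w)
    e₃ = solve-∀

-- Summed over B, this bounds the total there from below by 2 q minus the number of singletons.
indicator-bound₂ : ∀ n → 1 ≤ n → 2 ≤ n + (if does (n ≟ 1) then 1 else 0)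
indicator-bound₂ 1             _ = ≤-refl
indicator-bound₂ (suc (suc n)) _ = s≤s (s≤s z≤n)

-- Measured against 3, size 1 falls short by 2 and size 2 by 1; the sum over B brings in the number
-- of lists of size 2.
indicator-bound₃ : ∀ n → 1 ≤ n →
  3 ≤ n + (2 * (if does (n ≟ 1) then 1 else 0) + (if does (n ≟ 2) then 1 else 0))
indicator-bound₃ 1                   _ = ≤-refl
indicator-bound₃ 2                   _ = ≤-refl
indicator-bound₃ (suc (suc (suc n))) _ = s≤s (s≤s (s≤s z≤n))

-- Lists defeating a small total

module _ {a q : ℕ} {f : Fin (a + q) → ℕ} (choosable : Choosable (K a q) f) where

  private
    fˡ : Fin a → ℕ
    fˡ i = f (i ↑ˡ q)

    fʳ : Fin q → ℕ
    fʳ j = f (a ↑ʳ j)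

  -- Lets the lists be prescribed separately on the two parts; properness becomes disjointness of
  -- the colours used on them.
  colour-parts :
    (Lˡ : Fin a → List ℕ) → (∀ i → Unique (Lˡ i) × length (Lˡ i) ≡ fˡ i) →
    (Lʳ : Fin q → List ℕ) → (∀ j → Unique (Lʳ j) × length (Lʳ j) ≡ fʳ j) →
    Σ (Fin a → ℕ) λ cˡ → Σ (Fin q → ℕ) λ cʳ →
      (∀ i → cˡ i ∈ Lˡ i) × (∀ j → cʳ j ∈ Lʳ j) × (∀ i j → cˡ i ≢ cʳ j)
  colour-parts Lˡ okˡ Lʳ okʳ =
    let c , c∈ , proper = choosable A in
      c ∘ (_↑ˡ q) , c ∘ (a ↑ʳ_)
    , (λ i → subst (λ z → c (i ↑ˡ q) ∈ [ Lˡ , Lʳ ]′ z) (splitAt-↑ˡ a i q) (c∈ (i ↑ˡ q)))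
    , (λ j → subst (λ z → c (a ↑ʳ j) ∈ [ Lˡ , Lʳ ]′ z) (splitAt-↑ʳ a q j) (c∈ (a ↑ʳ j)))
    , λ i j → proper (i ↑ˡ q) (a ↑ʳ j) (inj₁
        ( subst (_< a) (sym (toℕ-↑ˡ i q)) (toℕ<n i)
        , subst (a ≤_) (sym (toℕ-↑ʳ a j)) (m≤m+n a (toℕ j))))
    where
    L : Fin (a + q) → List ℕ
    L v = [ Lˡ , Lʳ ]′ (splitAt a v)

    ok : ∀ v → Unique (L v) × length (L v) ≡ f v
    ok v with splitAt a v in eq
    ... | inj₁ i = proj₁ (okˡ i) , trans (proj₂ (okˡ i)) (cong f (splitAt⁻¹-↑ˡ eq))
    ... | inj₂ j = proj₁ (okʳ j) , trans (proj₂ (okʳ j)) (cong f (splitAt⁻¹-↑ʳ eq))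

    A : Assignment (a + q) f
    A = record { L = L ; distinct = proj₁ ∘ ok ; size = proj₂ ∘ ok }

  size-positive : ∀ j → 1 ≤ fʳ j
  size-positive j
    with _ , cʳ , _ , cʳ∈ , _ ← colour-parts (upTo ∘ fˡ) (upTo-size ∘ fˡ) (upTo ∘ fʳ) (upTo-size ∘ fʳ)
    = ≤-trans (s≤s z≤n) (∈-upTo⁻ (cʳ∈ j))

  -- Otherwise singleton lists {0}, …, {f i ∸ 1} on the right exhaust the list of i.
  few-singletons : ∀ i → count (λ j → fʳ j ≟ 1) < fˡ i
  few-singletons i with count (λ j → fʳ j ≟ 1) <? fˡ i
  ... | yes p = p
  ... | no ¬p
    with label , covers ← label-covering 0 (λ j → fʳ j ≟ 1) (upTo (fˡ i))
                            (subst (_≤ _) (sym (length-upTo (fˡ i))) (≮⇒≥ ¬p))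
    with cˡ , cʳ , cˡ∈ , cʳ∈ , proper ← colour-parts (upTo ∘ fˡ) (upTo-size ∘ fˡ)
           -- At size 1 this is the singleton of `label j`; translation keeps entries distinct at
           -- every size.
           (λ j → map (label j +_) (upTo (fʳ j)))
           (λ j → map⁺ (+-cancelˡ-≡ (label j) _ _) (upTo⁺ (fʳ j))
                , trans (length-map _ (upTo (fʳ j))) (length-upTo (fʳ j)))
    with j , fj≡1 , label≡ ← covers (cˡ∈ i)
    with here cʳ≡ ← subst₂ (λ x n → cʳ j ∈ map (x +_) (upTo n)) label≡ fj≡1 (cʳ∈ j)
    = contradiction (sym (trans cʳ≡ (+-identityʳ _))) (proper i j)

  -- Otherwise all words occur on A and all congruent pairs on B. By `both-parities` some pair has
  -- both colours used on A, and the vertex of B carrying it cannot be coloured.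
  few-pairs : ∀ t .{{_ : NonZero t}} m M → M ≤ m * t →
    2 ^ t ≤ count (λ i → fˡ i ≤? M) → count (λ j → fʳ j ≟ 2) < t * (m * m)
  few-pairs t m M M≤mt enough with count (λ j → fʳ j ≟ 2) <? t * (m * m)
  ... | yes p = p
  ... | no ¬p
    with word , word-covers ← label-covering (Vec.replicate t true) (λ i → fˡ i ≤? M) (bitVectors t)
           (subst (_≤ _) (sym (length-bitVectors t)) enough)
    with pair , pair-covers ← label-covering (0 , 0) (λ j → fʳ j ≟ 2) (congruentPairs t m)
           (subst (_≤ _) (sym (length-congruentPairs t m)) (≮⇒≥ ¬p))
    with cˡ , cʳ , cˡ∈ , cʳ∈ , proper ← colour-parts
           -- Each position below `fˡ i` is taken in the half that the word chooses for its class.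
           (λ i → map (λ n → colour n (lookup (word i) (residue t n))) (upTo (fˡ i)))
           (λ i → map⁺ (colour-injective _ _) (upTo⁺ (fˡ i))
                , trans (length-map _ (upTo (fˡ i))) (length-upTo (fˡ i)))
           (λ j → pairList (pair j) (fʳ j)) (λ j → pairList-size (pair j) (fʳ j))
    -- The lists of size at most `M` stay within the positions below `m * t`, the range of the
    -- pairs.
    with i , i′ , k , l , k< , l< , k≡l , eqk , eql ← both-parities t (m * t) cˡ (λ β →
           let i , fi≤M , word≡ = word-covers (∈-bitVectors β)
               n , n∈ , eq = ∈-map⁻ _ (cˡ∈ i)
           in i , n , <-≤-trans (∈-upTo⁻ n∈) (≤-trans fi≤M M≤mt)
            , trans eq (cong (λ w → colour n (lookup w (residue t n))) word≡))
    with j , fj≡2 , pair≡ ← pair-covers (∈-congruentPairs t m k< l< k≡l)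
    with subst₂ (λ p n → cʳ j ∈ pairList p n) pair≡ fj≡2 (cʳ∈ j)
  ... | here eq         = contradiction (trans eqk (sym eq)) (proper i j)
  ... | there (here eq) = contradiction (trans eql (sym eq)) (proper i′ j)

  -- Counting list sizes over the two parts

  module _ (2≤a : 2 ≤ a) where

    private
      s = total fˡ
      r = total fʳ
      -- Truncated subtraction, which `2q≤total` shows to be the true excess.
      d = total f ∸ 2 * q
      q₁ = count (λ j → fʳ j ≟ 1)
      q₂ = count (λ j → fʳ j ≟ 2)

      total≡ : total f ≡ s + r
      total≡ = total-↑ a f

      -- By `few-singletons` every list on A is longer than `q₁`, and A has at least two vertices.
      2q₁≤s : 2 * q₁ ≤ s
      2q₁≤s = begin
        2 * q₁                ≤⟨ *-monoˡ-≤ q₁ 2≤a ⟩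
        a * q₁                ≡⟨ total-const a q₁ ⟨
        total {a} (λ _ → q₁)  ≤⟨ total-mono (λ i → <⇒≤ (few-singletons i)) ⟩
        s                     ∎
        where open ≤-Reasoning

      2q≤r+q₁ : q * 2 ≤ r + q₁
      2q≤r+q₁ = begin
        q * 2                ≡⟨ total-const q 2 ⟨
        total {q} (λ _ → 2)  ≤⟨ total-mono (λ j → indicator-bound₂ (fʳ j) (size-positive j)) ⟩
        total (λ j → fʳ j + indicator (λ j → fʳ j ≟ 1) j) ≡⟨ total-+ fʳ _ ⟩
        r + q₁               ∎
        where open ≤-Reasoning

      3q≤r+2q₁+q₂ : q * 3 ≤ r + (2 * q₁ + q₂)
      3q≤r+2q₁+q₂ = begin
        q * 3                ≡⟨ total-const q 3 ⟨
        total {q} (λ _ → 3)  ≤⟨ total-mono (λ j → indicator-bound₃ (fʳ j) (size-positive j)) ⟩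
        total (λ j → fʳ j + (2 * is₁ j + is₂ j))  ≡⟨ total-+ fʳ _ ⟩
        r + total (λ j → 2 * is₁ j + is₂ j)       ≡⟨ cong (r +_) (total-+ (λ j → 2 * is₁ j) is₂) ⟩
        r + (total (λ j → 2 * is₁ j) + q₂)        ≡⟨ cong (λ z → r + (z + q₂)) (total-* 2 is₁) ⟩
        r + (2 * q₁ + q₂)    ∎
        where
        open ≤-Reasoning
        is₁ is₂ : Fin q → ℕ
        is₁ = indicator (λ j → fʳ j ≟ 1)
        is₂ = indicator (λ j → fʳ j ≟ 2)

    -- The deficit `q₁` on B is made up by the sizes on A.
    2q≤total : 2 * q ≤ total f
    2q≤total = begin
      2 * q    ≡⟨ *-comm 2 q ⟩
      q * 2    ≤⟨ 2q≤r+q₁ ⟩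
      r + q₁   ≤⟨ +-monoʳ-≤ r (≤-trans (m≤m+n q₁ _) 2q₁≤s) ⟩
      r + s    ≡⟨ +-comm r s ⟩
      s + r    ≡⟨ total≡ ⟨
      total f  ∎
      where open ≤-Reasoning

    private
      s+r≡ : s + r ≡ 2 * q + d
      s+r≡ = trans (sym total≡) (sym (m+[n∸m]≡n 2q≤total))

      -- From r ≥ 2 q - q₁ ≥ 2 q - s / 2 and s + r = 2 q + d it follows that s / 2 ≤ d.
      s≤2d : s ≤ 2 * d
      s≤2d = +-cancelˡ-≤ (4 * q + s) _ _ (begin
        4 * q + s + s              ≡⟨ e₁ q s ⟩
        2 * (s + q * 2)            ≤⟨ *-monoʳ-≤ 2 (+-monoʳ-≤ s 2q≤r+q₁) ⟩
        2 * (s + (r + q₁))         ≡⟨ cong (2 *_) (+-assoc s r q₁) ⟨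
        2 * (s + r + q₁)           ≡⟨ cong (λ z → 2 * (z + q₁)) s+r≡ ⟩
        2 * (2 * q + d + q₁)       ≡⟨ e₂ q d q₁ ⟩
        4 * q + 2 * d + 2 * q₁     ≤⟨ +-monoʳ-≤ (4 * q + 2 * d) 2q₁≤s ⟩
        4 * q + 2 * d + s          ≡⟨ e₃ q d s ⟩
        4 * q + s + 2 * d          ∎)
        where
        open ≤-Reasoning
        e₁ : ∀ q s → 4 * q + s + s ≡ 2 * (s + q * 2)
        e₁ = solve-∀
        e₂ : ∀ q d x → 2 * (2 * q + d + x) ≡ 4 * q + 2 * d + 2 * x
        e₂ = solve-∀
        e₃ : ∀ q d s → 4 * q + 2 * d + s ≡ 4 * q + s + 2 * d
        e₃ = solve-∀

      -- Here r ≥ 3 q - 2 q₁ - q₂ ≥ 3 q - s - q₂, and s + r = 2 q + d.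
      q≤q₂+d : q ≤ q₂ + d
      q≤q₂+d = +-cancelˡ-≤ (2 * q + s) _ _ (begin
        2 * q + s + q                  ≡⟨ e₁ q s ⟩
        s + q * 3                      ≤⟨ +-monoʳ-≤ s 3q≤r+2q₁+q₂ ⟩
        s + (r + (2 * q₁ + q₂))        ≡⟨ +-assoc s r _ ⟨
        s + r + (2 * q₁ + q₂)          ≡⟨ cong (_+ (2 * q₁ + q₂)) s+r≡ ⟩
        2 * q + d + (2 * q₁ + q₂)      ≤⟨ +-monoʳ-≤ (2 * q + d) (+-monoˡ-≤ q₂ 2q₁≤s) ⟩
        2 * q + d + (s + q₂)           ≡⟨ e₂ q d s q₂ ⟩
        2 * q + s + (q₂ + d)           ∎)
        where
        open ≤-Reasoning
        e₁ : ∀ q s → 2 * q + s + q ≡ s + q * 3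
        e₁ = solve-∀
        e₂ : ∀ q d s x → 2 * q + d + (s + x) ≡ 2 * q + s + (x + d)
        e₂ = solve-∀

    -- Supplies `budget` with the bound of `few-pairs`, the words being placed on vertices of A
    -- whose lists have at most twice the average size.
    excess-large : ∀ t .{{_ : NonZero t}} → 2 * 2 ^ t ≤ a + 2 → a * a * t ≤ q →
      ¬ (d * d * 10000 < a * a * q * t * 108)
    excess-large t@(suc _) 2^t≤ a²t≤q d²< = budget a q t d M m 2≤a d²< a²t≤q
      (begin
        a * M      ≡⟨ *-comm a M ⟩
        M * a      ≤⟨ m/n*n≤m (2 * s) a ⟩
        2 * s      ≤⟨ *-monoʳ-≤ 2 s≤2d ⟩
        2 * (2 * d) ≡⟨ *-assoc 2 2 d ⟨
        4 * d      ≡⟨ *-comm 4 d ⟩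
        d * 4      ∎)
      (≤-trans q≤q₂+d (+-monoˡ-≤ d (<⇒≤ (few-pairs t m M (<⇒≤ (m<1+[m/n]*n M t)) 2^t≤small))))
      (≤-trans (+-monoʳ-≤ t (m/n*n≤m M t)) (≤-reflexive (+-comm t M)))
      where
      open ≤-Reasoning
      instance
        a≢0 : NonZero a
        a≢0 = >-nonZero (≤-trans (s≤s z≤n) 2≤a)

      M = 2 * s / a
      -- The successor gives `M < m * t`, while `m * t` exceeds `M` by at most `t`.
      m = suc (M / t)
      small = count (λ i → fˡ i ≤? M)

      -- Rounding down in `M` gives 2 s < a (M + 1), so twice Markov's inequality leaves strictly
      -- more than half of A.
      a<2*small : a < 2 * small
      a<2*small = *-cancelʳ-< (suc M) a (2 * small) (+-cancelˡ-< (a * suc M) _ _ (begin-strict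
        a * suc M + a * suc M             ≡⟨ cong (a * suc M +_) (+-identityʳ (a * suc M)) ⟨
        2 * (a * suc M)                   ≤⟨ *-monoʳ-≤ 2 (markov fˡ M) ⟩
        2 * (s + suc M * small)           ≡⟨ e s (suc M) small ⟩
        2 * s + 2 * small * suc M         <⟨ +-monoˡ-< (2 * small * suc M) (m<1+[m/n]*n (2 * s) a) ⟩
        suc M * a + 2 * small * suc M     ≡⟨ cong (_+ 2 * small * suc M) (*-comm (suc M) a) ⟩
        a * suc M + 2 * small * suc M     ∎))
        where
        e : ∀ s x y → 2 * (s + x * y) ≡ 2 * s + 2 * y * x
        e = solve-∀

      -- The strictness of `a<2*small` absorbs the 2 in `a + 2`.
      2^t≤small : 2 ^ t ≤ small
      2^t≤small = s≤s⁻¹ (*-cancelˡ-< 2 (2 ^ t) (suc small) (begin-strict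
        2 * 2 ^ t        ≤⟨ 2^t≤ ⟩
        a + 2            <⟨ +-monoˡ-< 2 a<2*small ⟩
        2 * small + 2    ≡⟨ e small ⟩
        2 * suc small    ∎))
        where
        e : ∀ x → 2 * x + 2 ≡ 2 * suc x
        e = solve-∀

-- Passing between t and log a

-- Either y ≥ 3 t > log a, or y < 3 t and the excess would be too small. The constant 36 / 10000 is
-- 0.06 squared, and 108 is 36 * 3.
log-bound : ∀ a q t .{{_ : NonZero t}} d → a + 3 ≤ 4 * 2 ^ t → ¬ (d * d * 10000 < a * a * q * t * 108) →
  (y : ℚ) → ℕtoℚ (10000 * d ^ 2) Q.< ℕtoℚ (36 * a ^ 2 * q) Q.* y → LogLt a y
log-bound a q t d a≤ ¬small y d²< = decide (ℕtoℚ (3 * t) QP.≤? y)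
  where
  open QP.≤-Reasoning
  d²≡ : 10000 * d ^ 2 ≡ d * d * 10000
  d²≡ = trans (*-comm 10000 (d ^ 2)) (cong (λ x → d * x * 10000) (*-identityʳ d))

  e : ∀ a q t c → a * (a * 1) * c * q * (3 * t) ≡ a * a * q * t * (c * 3)
  e = solve-∀

  a²≡ : 36 * a ^ 2 * q * (3 * t) ≡ a * a * q * t * 108
  a²≡ = trans (cong (λ x → x * q * (3 * t)) (*-comm 36 (a ^ 2))) (e a q t 36)

  -- A with-abstraction here would normalise the type of d²<, unfolding 10000 * d ^ 2.
  decide : Dec (ℕtoℚ (3 * t) Q.≤ y) → LogLt a y
  decide (yes 3t≤y) = 3t≤y⇒LogLt {t = t} a≤ 3t≤y
  decide (no 3t≰y)  = contradiction
    (subst₂ _<_ d²≡ a²≡ (ℕtoℚ-cancel-< {10000 * d ^ 2} {36 * a ^ 2 * q * (3 * t)} (begin-strict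
      ℕtoℚ (10000 * d ^ 2)                      <⟨ d²< ⟩
      ℕtoℚ (36 * a ^ 2 * q) Q.* y               ≤⟨ QP.*-monoˡ-≤-nonNeg (ℕtoℚ (36 * a ^ 2 * q))
                                                     {{Q.nonNegative (0≤ℕtoℚ (36 * a ^ 2 * q))}} (QP.<⇒≤ (QP.≰⇒> 3t≰y)) ⟩
      ℕtoℚ (36 * a ^ 2 * q) Q.* ℕtoℚ (3 * t)    ≡⟨ ℕtoℚ-* (36 * a ^ 2 * q) (3 * t) ⟨
      ℕtoℚ (36 * a ^ 2 * q * (3 * t))           ∎)))
    ¬small

-- The factor 4 of the hypothesis on q is spent on t < 4 y.
4a²y≤q⇒a²t≤q : ∀ a q t y .{{_ : NonZero t}} → 2 ^ t ≤ a → LogLt a y →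
  ℕtoℚ (4 * a ^ 2) Q.* y Q.≤ ℕtoℚ q → a * a * t ≤ q
4a²y≤q⇒a²t≤q a q t y 2^t≤a loga<y 4a²y≤q = ℕtoℚ-cancel-≤ {a * a * t} {q} (begin
  ℕtoℚ (a * a * t)                   ≡⟨ ℕtoℚ-* (a * a) t ⟩
  ℕtoℚ (a * a) Q.* ℕtoℚ t            ≤⟨ QP.*-monoˡ-≤-nonNeg (ℕtoℚ (a * a)) {{Q.nonNegative (0≤ℕtoℚ (a * a))}}
                                          (QP.<⇒≤ (LogLt⇒t<4y {t = t} 2^t≤a loga<y)) ⟩
  ℕtoℚ (a * a) Q.* (ℕtoℚ 4 Q.* y)    ≡⟨ QP.*-assoc (ℕtoℚ (a * a)) (ℕtoℚ 4) y ⟨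
  ℕtoℚ (a * a) Q.* ℕtoℚ 4 Q.* y      ≡⟨ cong (Q._* y) (ℕtoℚ-* (a * a) 4) ⟨
  ℕtoℚ (a * a * 4) Q.* y             ≡⟨ cong (λ n → ℕtoℚ n Q.* y) (e a) ⟩
  ℕtoℚ (4 * a ^ 2) Q.* y             ≤⟨ 4a²y≤q ⟩
  ℕtoℚ q                             ∎)
  where
  open QP.≤-Reasoning
  e : ∀ a → a * a * 4 ≡ 4 * (a * (a * 1))
  e = solve-∀

-- Takes t + 1 as the integer part of the binary logarithm of a + 2; a ≥ 2 makes t positive and a +
-- 2 ≤ 2 a. The three bounds serve the placing of words, t < 4 log a and log a < 3 t.
dyadic-exponent : ∀ a → 2 ≤ a → ∃[ t ] (NonZero t × 2 * 2 ^ t ≤ a + 2 × 2 ^ t ≤ a × a + 3 ≤ 4 * 2 ^ t)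
dyadic-exponent a 2≤a with dyadic-bounds (a + 2) {{>-nonZero (≤-trans (s≤s z≤n) (m≤n+m 2 a))}}
... | 0 , _ , a+2<2 = contradiction (m≤n+m 2 a) (<⇒≱ a+2<2)
... | 1 , _ , a+2<4 = contradiction (+-monoˡ-≤ 2 2≤a) (<⇒≱ a+2<4)
... | suc t@(suc _) , lower , upper = t , _ , lower , *-cancelˡ-≤ 2 (begin
    2 * 2 ^ t   ≤⟨ lower ⟩
    a + 2       ≤⟨ +-monoʳ-≤ a 2≤a ⟩
    a + a       ≡⟨ cong (a +_) (+-identityʳ a) ⟨
    2 * a       ∎)
  , subst₂ _≤_ (sym (+-suc a 2)) (sym (*-assoc 2 2 (2 ^ t))) upper
  where open ≤-Reasoning

-- The real inequalities are expressed through rationals: q > 4 a² log a by some `y` above log a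
-- with 4 a² y ≤ q, and the bound on the excess d in squared form, every rational above 10000 d² /
-- (36 a² q) being above log a. Treating every choosable `f` bounds the minimum.
theorem4p2 : (a q : ℕ) → 2 ≤ a →
    (∃[ y ] (LogLt a y × ℕtoℚ (4 * a ^ 2) Q.* y Q.≤ ℕtoℚ q)) →
    (f : Fin (a Data.Nat.+ q) → ℕ) → Choosable (K a q) f →
    (2 * q ≤ total f) ×
    ((y : ℚ) → ℕtoℚ (10000 * (total f ∸ 2 * q) ^ 2) Q.< ℕtoℚ (36 * a ^ 2 * q) Q.* y → LogLt a y)
theorem4p2 a q 2≤a (y₀ , loga<y₀ , 4a²y₀≤q) f choosable =
  let t , t≢0 , 2*2^t≤a+2 , 2^t≤a , a+3≤4*2^t = dyadic-exponent a 2≤a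
      instance _ = t≢0
  in 2q≤total choosable 2≤a
   , log-bound a q t (total f ∸ 2 * q) a+3≤4*2^t
       (excess-large choosable 2≤a t 2*2^t≤a+2 (4a²y≤q⇒a²t≤q a q t y₀ 2^t≤a loga<y₀ 4a²y₀≤q))
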